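{- A non-trivial MV-chain $A$ is profinite if and only if $A$ is isomorphic to $\mathrm{L}_n$ for some integer $n\geq 2$.
   Context: An MV-algebra is an Abelian monoid $(A,\oplus,0)$ with an involution $\neg:A\to A$ such that $\neg 0\oplus x=\neg 0$ and $\neg(\neg x\oplus y)\oplus y=\neg(\neg y\oplus x)\oplus x$ for all $x,y\in A$; its order is $x\le y$ iff $\neg x\oplus y=\neg 0$. It is non-trivial if $0\ne\neg 0$, and is an MV-chain if its order is total. The real unit interval $[0,1]$ is an MV-algebra with $x\oplus y=\min\{x+y,1\}$, $\neg x=1-x$ and identity element $0$; for $n\ge2$, $\mathrm{L}_n=\{0,\frac{1}{n-1},\dots,\frac{n-2}{n-1},1\}$ is a subalgebra of $[0,1]$. An MV-algebra is profinite if it is isomorphic to an inverse limit of an inverse system of finite MV-algebras indexed by a directed poset. -}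

module Defs where

open import Algebra.Bundles using (CommutativeMonoid)
open import Algebra.Core using (Op₁; Op₂)
open import Algebra.Definitions using (Involutive)
open import Algebra.Morphism.Structures using (IsMonoidHomomorphism)
open import Algebra.Structures using (IsCommutativeMonoid)
open import Data.Fin.Base using (Fin)
open import Data.Integer.Base as ℤ using (+_)
import Data.Integer.Properties as ℤ
open import Data.Nat.Base as ℕ using (ℕ; _∸_; NonZero)
import Data.Nat.Properties as ℕ
open import Data.Product.Base using (Σ; Σ-syntax; ∃-syntax; _×_; _,_; proj₁; proj₂)
open import Data.Rational.Base using (ℚ; 0ℚ; 1ℚ; _/_; _+_; _-_; _⊓_; _⊔_; _≤_; toℚᵘ)
open import Data.Rational.Properties
open import Data.Rational.Solver using (module +-*-Solver)
open import Data.Rational.Unnormalised.Base as ℚᵘ using (mkℚᵘ; *≡*)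
import Data.Rational.Unnormalised.Properties as ℚᵘ
open import Data.Sum.Base using (inj₁; inj₂)
open import Function.Bundles using (Inverse)
open import Function.Definitions using (Bijective)
open import Level as Level using (Level; 0ℓ)
open import Relation.Binary.Bundles using (Setoid; Poset)
open import Relation.Binary.Core using (Rel)
open import Relation.Binary.Definitions using (Total)
open import Relation.Binary.PropositionalEquality
  using (_≡_; refl; sym; trans; cong; cong₂; setoid; module ≡-Reasoning)
open import Relation.Unary using (Pred)

private
  variable
    c ℓ c′ ℓ′ p i : Level

record MVAlgebra c ℓ : Set (Level.suc (c Level.⊔ ℓ)) where
  infix  8 ¬_
  infixl 6 _⊕_
  infix  4 _≈_ _≤ᴹ_
  field
    Carrier             : Set c
    _≈_                 : Rel Carrier ℓ
    _⊕_                 : Op₂ Carrier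
    0#                  : Carrier
    ¬_                  : Op₁ Carrier
    isCommutativeMonoid : IsCommutativeMonoid _≈_ _⊕_ 0#
    ¬-cong              : ∀ {x y} → x ≈ y → ¬ x ≈ ¬ y
    ¬-involutive        : Involutive _≈_ ¬_
    ¬0-zeroˡ            : ∀ x → ¬ 0# ⊕ x ≈ ¬ 0#
    ⊕-¬-exchange        : ∀ x y → ¬ (¬ x ⊕ y) ⊕ y ≈ ¬ (¬ y ⊕ x) ⊕ x

  commutativeMonoid : CommutativeMonoid c ℓ
  commutativeMonoid = record { isCommutativeMonoid = isCommutativeMonoid }

  open CommutativeMonoid commutativeMonoid public using (setoid; rawMonoid; _≉_)

  _≤ᴹ_ : Rel Carrier ℓ
  x ≤ᴹ y = ¬ x ⊕ y ≈ ¬ 0#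

Nontrivial : MVAlgebra c ℓ → Set ℓ
Nontrivial A = 0# ≉ ¬ 0#
  where open MVAlgebra A

IsChain : MVAlgebra c ℓ → Set (c Level.⊔ ℓ)
IsChain A = Total _≤ᴹ_
  where open MVAlgebra A

Finite : MVAlgebra c ℓ → Set (c Level.⊔ ℓ)
Finite A = ∃[ n ] Inverse (MVAlgebra.setoid A) (setoid (Fin n))

module _ (A : MVAlgebra c ℓ) (B : MVAlgebra c′ ℓ′) where
  private
    module A = MVAlgebra A
    module B = MVAlgebra B

  record IsMVHomomorphism (f : A.Carrier → B.Carrier) : Set (c Level.⊔ ℓ Level.⊔ ℓ′) where
    field
      isMonoidHomomorphism : IsMonoidHomomorphism A.rawMonoid B.rawMonoid f
      ¬-homo               : ∀ x → f (A.¬ x) B.≈ B.¬ f x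

  infix 4 _≅_

  record _≅_ : Set (c Level.⊔ ℓ Level.⊔ c′ Level.⊔ ℓ′) where
    field
      to               : A.Carrier → B.Carrier
      isMVHomomorphism : IsMVHomomorphism to
      bijective        : Bijective A._≈_ B._≈_ to

record IsSubuniverse (A : MVAlgebra c ℓ) (P : Pred (MVAlgebra.Carrier A) p)
       : Set (c Level.⊔ p) where
  open MVAlgebra A
  field
    0-closed : P 0#
    ⊕-closed : ∀ {x y} → P x → P y → P (x ⊕ y)
    ¬-closed : ∀ {x} → P x → P (¬ x)

-- Elements carry a proof of membership, but equality ignores it.
Subalgebra : (A : MVAlgebra c ℓ) {P : Pred (MVAlgebra.Carrier A) p} →
             IsSubuniverse A P → MVAlgebra (c Level.⊔ p) ℓ
Subalgebra A {P} closed = record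
  { Carrier = Σ Carrier P
  ; _≈_     = λ x y → proj₁ x ≈ proj₁ y
  ; _⊕_     = λ (x , Px) (y , Py) → x ⊕ y , ⊕-closed Px Py
  ; 0#      = 0# , 0-closed
  ; ¬_      = λ (x , Px) → ¬ x , ¬-closed Px
  ; isCommutativeMonoid = record
    { isMonoid = record
      { isSemigroup = record
        { isMagma = record
          { isEquivalence = record
            { refl  = M.refl
            ; sym   = M.sym
            ; trans = M.trans
            }
          ; ∙-cong = M.∙-cong
          }
        ; assoc = λ x y z → M.assoc (proj₁ x) (proj₁ y) (proj₁ z)
        }
      ; identity = (λ x → M.identityˡ (proj₁ x)) , (λ x → M.identityʳ (proj₁ x))
      }
    ; comm = λ x y → M.comm (proj₁ x) (proj₁ y)
    }
  ; ¬-cong       = ¬-cong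
  ; ¬-involutive = λ x → ¬-involutive (proj₁ x)
  ; ¬0-zeroˡ     = λ x → ¬0-zeroˡ (proj₁ x)
  ; ⊕-¬-exchange = λ x y → ⊕-¬-exchange (proj₁ x) (proj₁ y)
  }
  where
  open MVAlgebra A
  open IsSubuniverse closed
  module M = IsCommutativeMonoid isCommutativeMonoid

Product : {I : Set i} → (I → MVAlgebra c ℓ) → MVAlgebra (i Level.⊔ c) (i Level.⊔ ℓ)
Product {I = I} A = record
  { Carrier = ∀ k → A.Carrier k
  ; _≈_     = λ x y → ∀ k → A._≈_ k (x k) (y k)
  ; _⊕_     = λ x y k → A._⊕_ k (x k) (y k)
  ; 0#      = λ k → A.0# k
  ; ¬_      = λ x k → A.¬_ k (x k)
  ; isCommutativeMonoid = record
    { isMonoid = record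
      { isSemigroup = record
        { isMagma = record
          { isEquivalence = record
            { refl  = λ k → M.refl k
            ; sym   = λ p k → M.sym k (p k)
            ; trans = λ p q k → M.trans k (p k) (q k)
            }
          ; ∙-cong = λ p q k → M.∙-cong k (p k) (q k)
          }
        ; assoc = λ x y z k → M.assoc k (x k) (y k) (z k)
        }
      ; identity = (λ x k → M.identityˡ k (x k)) , (λ x k → M.identityʳ k (x k))
      }
    ; comm = λ x y k → M.comm k (x k) (y k)
    }
  ; ¬-cong       = λ p k → A.¬-cong k (p k)
  ; ¬-involutive = λ x k → A.¬-involutive k (x k)
  ; ¬0-zeroˡ     = λ x k → A.¬0-zeroˡ k (x k)
  ; ⊕-¬-exchange = λ x y k → A.⊕-¬-exchange k (x k) (y k)
  }
  where
  module A (k : I) = MVAlgebra (A k)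
  module M (k : I) = IsCommutativeMonoid (A.isCommutativeMonoid k)

record IsDirected {c ℓ₁ ℓ₂} (P : Poset c ℓ₁ ℓ₂) : Set (c Level.⊔ ℓ₂) where
  open Poset P using (Carrier) renaming (_≤_ to _⊑_)
  field
    inhabited  : Carrier
    upperBound : ∀ j k → ∃[ m ] j ⊑ m × k ⊑ m

-- Transition maps are indexed by proofs of j ⊑ k.  Since φ-∘ holds for every
-- proof of j ⊑ m, φ-id and φ-∘ together make them independent of that proof.
record InverseSystem u : Set (Level.suc u) where
  field
    index      : Poset u u u
    isDirected : IsDirected index
  open Poset index public using () renaming (Carrier to I; _≤_ to _⊑_)
  field
    algebra : I → MVAlgebra u u
  module A (k : I) = MVAlgebra (algebra k)
  field
    φ      : ∀ {j k} → j ⊑ k → A.Carrier k → A.Carrier j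
    φ-homo : ∀ {j k} (j⊑k : j ⊑ k) → IsMVHomomorphism (algebra k) (algebra j) (φ j⊑k)
    φ-id   : ∀ {j} (j⊑j : j ⊑ j) x → A._≈_ j (φ j⊑j x) x
    φ-∘    : ∀ {j k m} (j⊑k : j ⊑ k) (k⊑m : k ⊑ m) (j⊑m : j ⊑ m) x →
             A._≈_ j (φ j⊑k (φ k⊑m x)) (φ j⊑m x)

  IsThread : Pred (∀ k → A.Carrier k) u
  IsThread x = ∀ {j k} (j⊑k : j ⊑ k) → A._≈_ j (φ j⊑k (x k)) (x j)

  threads : IsSubuniverse (Product algebra) IsThread
  threads = record
    { 0-closed = λ j⊑k → H.ε-homo j⊑k
    ; ⊕-closed = λ Px Py {j} j⊑k →
        S.trans j (H.homo j⊑k _ _) (S.∙-cong j (Px j⊑k) (Py j⊑k))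
    ; ¬-closed = λ Px {j} j⊑k →
        S.trans j (IsMVHomomorphism.¬-homo (φ-homo j⊑k) _) (A.¬-cong j (Px j⊑k))
    }
    where
    module S (k : I) = IsCommutativeMonoid (A.isCommutativeMonoid k)
    module H {j k} (j⊑k : j ⊑ k) =
      IsMonoidHomomorphism (IsMVHomomorphism.isMonoidHomomorphism (φ-homo j⊑k))

  limit : MVAlgebra u u
  limit = Subalgebra (Product algebra) threads

-- "Set" is read as "type in the universe Set u", for an arbitrary fixed u.
Profinite : ∀ {u} → MVAlgebra u u → Set (Level.suc u)
Profinite {u} A = Σ[ S ∈ InverseSystem u ]
  (∀ k → Finite (InverseSystem.algebra S k)) × (A ≅ InverseSystem.limit S)

module Truncated+ where
  0≤1 : 0ℚ ≤ 1ℚ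
  0≤1 = nonNegative⁻¹ 1ℚ

  infixl 6 _⊞_
  _⊞_ : ℚ → ℚ → ℚ
  x ⊞ y = (x + y) ⊓ 1ℚ

  1-[1-x] : ∀ x → 1ℚ - (1ℚ - x) ≡ x
  1-[1-x] = solve 1 (λ x → con 1ℚ :- (con 1ℚ :- x) := x) refl
    where open +-*-Solver

  1-antimono : ∀ {x y} → x ≤ y → 1ℚ - y ≤ 1ℚ - x
  1-antimono x≤y = +-monoʳ-≤ 1ℚ (neg-antimono-≤ x≤y)

  0≤1-x : ∀ {x} → x ≤ 1ℚ → 0ℚ ≤ 1ℚ - x
  0≤1-x x≤1 = ≤-trans (≤-reflexive (sym (+-inverseʳ 1ℚ))) (1-antimono x≤1)

  1-x≤1 : ∀ {x} → 0ℚ ≤ x → 1ℚ - x ≤ 1ℚ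
  1-x≤1 0≤x = ≤-trans (1-antimono 0≤x) (≤-reflexive refl)

  0≤+ : ∀ {x y} → 0ℚ ≤ x → 0ℚ ≤ y → 0ℚ ≤ x + y
  0≤+ 0≤x 0≤y = +-mono-≤ 0≤x 0≤y

  ≤+ : ∀ x {y} → 0ℚ ≤ y → x ≤ x + y
  ≤+ x 0≤y = ≤-trans (≤-reflexive (sym (+-identityʳ x))) (+-monoʳ-≤ x 0≤y)

  ⊞-truncˡ : ∀ s {z} → 0ℚ ≤ z → (s ⊓ 1ℚ) ⊞ z ≡ s ⊞ z
  ⊞-truncˡ s {z} 0≤z = begin
    ((s ⊓ 1ℚ) + z) ⊓ 1ℚ          ≡⟨ cong (_⊓ 1ℚ) (mono-≤-distrib-⊓ (+-monoˡ-≤ z) s 1ℚ) ⟩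
    ((s + z) ⊓ (1ℚ + z)) ⊓ 1ℚ    ≡⟨ ⊓-assoc (s + z) (1ℚ + z) 1ℚ ⟩
    (s + z) ⊓ ((1ℚ + z) ⊓ 1ℚ)    ≡⟨ cong ((s + z) ⊓_) (p≥q⇒p⊓q≡q (≤+ 1ℚ 0≤z)) ⟩
    (s + z) ⊓ 1ℚ                 ∎
    where open ≡-Reasoning

  ⊞-comm : ∀ x y → x ⊞ y ≡ y ⊞ x
  ⊞-comm x y = cong (_⊓ 1ℚ) (+-comm x y)

  ⊞-assoc : ∀ {x} y {z} → 0ℚ ≤ x → 0ℚ ≤ z → (x ⊞ y) ⊞ z ≡ x ⊞ (y ⊞ z)
  ⊞-assoc {x} y {z} 0≤x 0≤z = begin
    (x ⊞ y) ⊞ z    ≡⟨ ⊞-truncˡ (x + y) 0≤z ⟩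
    (x + y) ⊞ z    ≡⟨ cong (_⊓ 1ℚ) (trans (+-assoc x y z) (+-comm x (y + z))) ⟩
    (y + z) ⊞ x    ≡⟨ ⊞-truncˡ (y + z) 0≤x ⟨
    (y ⊞ z) ⊞ x    ≡⟨ ⊞-comm (y ⊞ z) x ⟩
    x ⊞ (y ⊞ z)    ∎
    where open ≡-Reasoning

  ⊞-max : ∀ {x y} → x ≤ 1ℚ → y ≤ 1ℚ → (1ℚ - ((1ℚ - x) ⊞ y)) ⊞ y ≡ x ⊔ y
  ⊞-max {x} {y} x≤1 y≤1 = begin
    ((1ℚ - (((1ℚ - x) + y) ⊓ 1ℚ)) + y) ⊓ 1ℚ
      ≡⟨ cong (_⊓ 1ℚ) (antimono-≤-distrib-⊓ (λ a≤b → +-monoˡ-≤ y (1-antimono a≤b)) ((1ℚ - x) + y) 1ℚ) ⟩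
    (((1ℚ - ((1ℚ - x) + y)) + y) ⊔ ((1ℚ - 1ℚ) + y)) ⊓ 1ℚ
      ≡⟨ cong (_⊓ 1ℚ) (cong₂ _⊔_ (eq x y) (+-identityˡ y)) ⟩
    (x ⊔ y) ⊓ 1ℚ
      ≡⟨ p≤q⇒p⊓q≡p (⊔-lub x≤1 y≤1) ⟩
    x ⊔ y ∎
    where
    open ≡-Reasoning
    eq : ∀ x y → (1ℚ - ((1ℚ - x) + y)) + y ≡ x
    eq = solve 2 (λ x y → (con 1ℚ :- ((con 1ℚ :- x) :+ y)) :+ y := x) refl
      where open +-*-Solver

open Truncated+

-- The rational part of the real unit interval; it contains every Łₙ.
[0,1] : MVAlgebra 0ℓ 0ℓ
[0,1] = record
  { Carrier = Σ[ x ∈ ℚ ] (0ℚ ≤ x × x ≤ 1ℚ)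
  ; _≈_     = λ x y → proj₁ x ≡ proj₁ y
  ; _⊕_     = λ (x , 0≤x , _) (y , 0≤y , _) →
                (x + y) ⊓ 1ℚ , ⊓-glb (0≤+ 0≤x 0≤y) 0≤1 , p⊓q≤q (x + y) 1ℚ
  ; 0#      = 0ℚ , ≤-refl , 0≤1
  ; ¬_      = λ (x , 0≤x , x≤1) → 1ℚ - x , 0≤1-x x≤1 , 1-x≤1 0≤x
  ; isCommutativeMonoid = record
    { isMonoid = record
      { isSemigroup = record
        { isMagma = record
          { isEquivalence = record { refl = refl ; sym = sym ; trans = trans }
          ; ∙-cong        = cong₂ _⊞_
          }
        ; assoc = λ (_ , 0≤x , _) (y , _) (_ , 0≤z , _) → ⊞-assoc y 0≤x 0≤z
        }
      ; identity = identityˡ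
                 , λ x@(p , _) → trans (⊞-comm p 0ℚ) (identityˡ x)
      }
    ; comm = λ (x , _) (y , _) → ⊞-comm x y
    }
  ; ¬-cong       = cong (1ℚ -_)
  ; ¬-involutive = λ (x , _) → 1-[1-x] x
  ; ¬0-zeroˡ     = λ (x , 0≤x , _) → p≥q⇒p⊓q≡q (≤+ 1ℚ 0≤x)
  ; ⊕-¬-exchange = λ (x , _ , x≤1) (y , _ , y≤1) →
      trans (⊞-max x≤1 y≤1) (trans (⊔-comm x y) (sym (⊞-max y≤1 x≤1)))
  }
  where
  identityˡ : ∀ ((x , _) : Σ[ x ∈ ℚ ] (0ℚ ≤ x × x ≤ 1ℚ)) → 0ℚ ⊞ x ≡ x
  identityˡ (x , _ , x≤1) = trans (cong (_⊓ 1ℚ) (+-identityˡ x)) (p≤q⇒p⊓q≡p x≤1)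

IsFraction : (d : ℕ) .{{_ : NonZero d}} → Pred (MVAlgebra.Carrier [0,1]) 0ℓ
IsFraction d (x , _) = ∃[ k ] k ℕ.≤ d × x ≡ + k / d

module Fractions (e : ℕ) where
  private
    d : ℕ
    d = ℕ.suc e

  +-/ : ∀ j k → + j / d + + k / d ≡ + (j ℕ.+ k) / d
  +-/ j k = toℚᵘ-injective (begin
    toℚᵘ (+ j / d + + k / d)           ≈⟨ toℚᵘ-homo-+ (+ j / d) (+ k / d) ⟩
    toℚᵘ (+ j / d) ℚᵘ.+ toℚᵘ (+ k / d) ≈⟨ ℚᵘ.+-cong (toℚᵘ-fromℚᵘ (mkℚᵘ (+ j) e)) (toℚᵘ-fromℚᵘ (mkℚᵘ (+ k) e)) ⟩
    mkℚᵘ (+ j) e ℚᵘ.+ mkℚᵘ (+ k) e     ≈⟨ *≡* eq ⟩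
    mkℚᵘ (+ (j ℕ.+ k)) e               ≈⟨ toℚᵘ-fromℚᵘ (mkℚᵘ (+ (j ℕ.+ k)) e) ⟨
    toℚᵘ (+ (j ℕ.+ k) / d)             ∎)
    where
    open import Relation.Binary.Reasoning.Setoid ℚᵘ.≃-setoid
    eq : (+ j ℤ.* + d ℤ.+ + k ℤ.* + d) ℤ.* + d ≡ + (j ℕ.+ k) ℤ.* (+ d ℤ.* + d)
    eq = trans (cong (ℤ._* + d) (sym (ℤ.*-distribʳ-+ (+ d) (+ j) (+ k))))
               (ℤ.*-assoc (+ (j ℕ.+ k)) (+ d) (+ d))

  d/d : + d / d ≡ 1ℚ
  d/d = toℚᵘ-injective (ℚᵘ.≃-trans (toℚᵘ-fromℚᵘ (mkℚᵘ (+ d) e)) (*≡* (ℤ.*-comm (+ d) (+ 1))))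

  0/d : 0ℚ ≡ + 0 / d
  0/d = toℚᵘ-injective (ℚᵘ.≃-trans (*≡* refl) (ℚᵘ.≃-sym (toℚᵘ-fromℚᵘ (mkℚᵘ (+ 0) e))))

  0≤/ : ∀ k → 0ℚ ≤ + k / d
  0≤/ k = nonNegative⁻¹ (+ k / d) {{normalize-nonNeg k d}}

  1-/ : ∀ {k} → k ℕ.≤ d → 1ℚ - + k / d ≡ + (d ∸ k) / d
  1-/ {k} k≤d = begin
    1ℚ - + k / d                             ≡⟨ cong (_- + k / d) (trans (sym d/d) (cong (λ m → + m / d) (sym (ℕ.m∸n+n≡m k≤d)))) ⟩
    + (d ∸ k ℕ.+ k) / d - + k / d            ≡⟨ cong (_- + k / d) (sym (+-/ (d ∸ k) k)) ⟩
    (+ (d ∸ k) / d + + k / d) - + k / d      ≡⟨ eq (+ (d ∸ k) / d) (+ k / d) ⟩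
    + (d ∸ k) / d                            ∎
    where
    open ≡-Reasoning
    eq : ∀ x y → (x + y) - y ≡ x
    eq = solve 2 (λ x y → (x :+ y) :- y := x) refl
      where open +-*-Solver

  /≤1 : ∀ {k} → k ℕ.≤ d → + k / d ≤ 1ℚ
  /≤1 {k} k≤d = begin
    + k / d                      ≤⟨ ≤+ (+ k / d) (0≤/ (d ∸ k)) ⟩
    + k / d + + (d ∸ k) / d      ≡⟨ +-/ k (d ∸ k) ⟩
    + (k ℕ.+ (d ∸ k)) / d        ≡⟨ cong (λ m → + m / d) (ℕ.m+[n∸m]≡n k≤d) ⟩
    + d / d                      ≡⟨ d/d ⟩
    1ℚ                           ∎
    where open ≤-Reasoning

  1≤/ : ∀ {k} → d ℕ.≤ k → 1ℚ ≤ + k / d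
  1≤/ {k} d≤k = begin
    1ℚ                           ≡⟨ d/d ⟨
    + d / d                      ≤⟨ ≤+ (+ d / d) (0≤/ (k ∸ d)) ⟩
    + d / d + + (k ∸ d) / d      ≡⟨ +-/ d (k ∸ d) ⟩
    + (d ℕ.+ (k ∸ d)) / d        ≡⟨ cong (λ m → + m / d) (ℕ.m+[n∸m]≡n d≤k) ⟩
    + k / d                      ∎
    where open ≤-Reasoning

  ⊞-/ : ∀ j k → ∃[ m ] m ℕ.≤ d × (+ j / d) ⊞ (+ k / d) ≡ + m / d
  ⊞-/ j k with ℕ.≤-total (j ℕ.+ k) d
  ... | inj₁ j+k≤d = j ℕ.+ k , j+k≤d
                   , trans (cong (_⊓ 1ℚ) (+-/ j k)) (p≤q⇒p⊓q≡p (/≤1 j+k≤d))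
  ... | inj₂ d≤j+k = d , ℕ.≤-refl
                   , trans (cong (_⊓ 1ℚ) (+-/ j k)) (trans (p≥q⇒p⊓q≡q (1≤/ d≤j+k)) (sym d/d))

open Fractions

fractions : (d : ℕ) .{{_ : NonZero d}} → IsSubuniverse [0,1] (IsFraction d)
fractions d@(ℕ.suc e) = record
  { 0-closed = 0 , ℕ.z≤n , 0/d e
  ; ⊕-closed = λ { (j , _ , refl) (k , _ , refl) → ⊞-/ e j k }
  ; ¬-closed = λ { (k , k≤d , refl) → d ∸ k , ℕ.m∸n≤m d k , 1-/ e k≤d }
  }

-- {0, 1/(n-1), …, (n-2)/(n-1), 1}
Ł : (n : ℕ) → 2 ℕ.≤ n → MVAlgebra 0ℓ 0ℓ
Ł n 2≤n = Subalgebra [0,1] (fractions (n ∸ 1) {{ℕ.>-nonZero (ℕ.m<n⇒0<n∸m 2≤n)}})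

{-# OPTIONS --safe #-}

-- If a non-trivial MV-chain A is the limit of finite algebras A_k, choose k
-- with A_k non-trivial.  The projection π_k is injective: suppose π_k x = 0,
-- let m ≥ k, and choose N such that the multiples of x stabilise at N x in
-- the finite algebra A_m.  Either x ≤ ¬ N x, and then x vanishes in A_m, or
-- ¬ N x ≤ x, and then N x = 1 in A_m, hence 0 = 1 in A_k.  So A is finite; it
-- therefore has an atom a, and A = {0, a, 2a, …, da = 1} is a copy of Łₙ for
-- n = d + 1.

module Submission where

open import Defs
open import Axiom.ExcludedMiddle using (ExcludedMiddle)
open import Data.Nat.Base using (_≤_)
open import Data.Product.Base using (∃-syntax; Σ-syntax)
open import Function.Bundles using (_⇔_)

open import Algebra.Bundles using (CommutativeMonoid)
open import Algebra.Morphism.Structures using (IsMonoidHomomorphism)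
import Algebra.Properties.Monoid.Mult as Mult
open import Data.Empty using (⊥-elim)
open import Data.Fin.Base using (Fin; toℕ; fromℕ<)
open import Data.Fin.Properties
  using (pigeonhole; toℕ-fromℕ<; toℕ-injective; toℕ≤pred[n])
open import Data.Integer.Base using (+_)
import Data.Integer.Properties as ℤ
open import Data.List.Base using (List; []; _∷_; allFin)
open import Data.List.Membership.Propositional using (_∈_)
open import Data.List.Membership.Propositional.Properties using (∈-allFin)
open import Data.List.Relation.Unary.Any using (here; there)
open import Data.Nat.Base as ℕ using (ℕ; zero; suc; z≤n; s≤s; _<_; _∸_)
import Data.Nat.Properties as ℕ
open import Data.Product.Base using (_×_; _,_; proj₁; proj₂)
open import Data.Rational.Base using (ℚ; 1ℚ; _/_; _⊓_)
open import Data.Rational.Properties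
  using (fromℚᵘ-injective; p≤q⇒p⊓q≡p; p≥q⇒p⊓q≡q)
open import Data.Rational.Unnormalised.Base using (mkℚᵘ; *≡*)
open import Data.Sum.Base using (_⊎_; inj₁; inj₂)
open import Data.Unit.Polymorphic.Base using (⊤; tt)
open import Function.Base using (_∘_)
open import Function.Bundles using (Injection; mk⇔)
open import Function.Definitions using (Injective)
open import Function.Properties.Inverse using (Inverse⇒Injection)
open import Level using (Level)
open import Relation.Binary.Definitions using (Decidable; tri<; tri≈; tri>)
open import Relation.Binary.PropositionalEquality as ≡ using (_≡_)
import Relation.Binary.Reasoning.Setoid as SetoidReasoning
open import Relation.Nullary.Decidable.Core using (yes; no)

-- Arithmetic of MV-algebras: order, absorption and multiples.

module MVProperties {c ℓ : Level} (A : MVAlgebra c ℓ) where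
  open MVAlgebra A public
  open CommutativeMonoid commutativeMonoid public
    using (monoid; refl; sym; trans; assoc; comm; identityˡ)
    renaming (∙-cong to ⊕-cong; ∙-congˡ to ⊕-congˡ; ∙-congʳ to ⊕-congʳ)
  open Mult monoid public using (×-congʳ; ×-homo-+) renaming (_×_ to _·_)
  open SetoidReasoning setoid

  1# : Carrier
  1# = ¬ 0#

  ¬1≈0 : ¬ 1# ≈ 0#
  ¬1≈0 = ¬-involutive 0#

  ¬x≈0⇒x≈1 : ∀ {x} → ¬ x ≈ 0# → x ≈ 1#
  ¬x≈0⇒x≈1 ¬x≈0 = trans (sym (¬-involutive _)) (¬-cong ¬x≈0)

  ¬x≈1⇒x≈0 : ∀ {x} → ¬ x ≈ 1# → x ≈ 0#
  ¬x≈1⇒x≈0 ¬x≈1 = trans (sym (¬-involutive _)) (trans (¬-cong ¬x≈1) ¬1≈0)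

  1-zeroʳ : ∀ x → x ⊕ 1# ≈ 1#
  1-zeroʳ x = trans (comm x 1#) (¬0-zeroˡ x)

  -- The exchange axiom at `1#` and `x`: the left side simplifies to `¬ x ⊕ x`, and the right side
  -- ends in the absorbing summand `1#`.
  ⊕-complementˡ : ∀ x → ¬ x ⊕ x ≈ 1#
  ⊕-complementˡ x = begin
    ¬ x ⊕ x                  ≈⟨ ⊕-congʳ (¬-cong (trans (⊕-congʳ ¬1≈0) (identityˡ x))) ⟨
    ¬ (¬ 1# ⊕ x) ⊕ x         ≈⟨ ⊕-¬-exchange 1# x ⟩
    ¬ (¬ x ⊕ 1#) ⊕ 1#        ≈⟨ 1-zeroʳ _ ⟩
    1#                       ∎

  ≤-respʳ : ∀ {x y z} → y ≈ z → x ≤ᴹ y → x ≤ᴹ z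
  ≤-respʳ y≈z x≤y = trans (⊕-congˡ (sym y≈z)) x≤y

  ≤-respˡ : ∀ {x y z} → x ≈ y → x ≤ᴹ z → y ≤ᴹ z
  ≤-respˡ x≈y x≤z = trans (⊕-congʳ (¬-cong (sym x≈y))) x≤z

  x≤y⊕x : ∀ x y → x ≤ᴹ y ⊕ x
  x≤y⊕x x y = begin
    ¬ x ⊕ (y ⊕ x)    ≈⟨ ⊕-congˡ (comm y x) ⟩
    ¬ x ⊕ (x ⊕ y)    ≈⟨ assoc (¬ x) x y ⟨
    ¬ x ⊕ x ⊕ y      ≈⟨ ⊕-congʳ (⊕-complementˡ x) ⟩
    1# ⊕ y           ≈⟨ ¬0-zeroˡ y ⟩
    1#               ∎

  -- Here `¬ (¬ y ⊕ x)` is the truncated difference `y ⊖ x`. For `x ≤ᴹ y` the opposite difference is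
  -- `0#`, so the exchange axiom gives `y = (y ⊖ x) ⊕ x`. The order is thus the divisibility order
  -- of the monoid, from which transitivity and monotonicity follow.
  ≤⇒≈⊕ : ∀ {x y} → x ≤ᴹ y → y ≈ ¬ (¬ y ⊕ x) ⊕ x
  ≤⇒≈⊕ {x} {y} x≤y = begin
    y                  ≈⟨ identityˡ y ⟨
    0# ⊕ y             ≈⟨ ⊕-congʳ (trans (¬-cong x≤y) ¬1≈0) ⟨
    ¬ (¬ x ⊕ y) ⊕ y    ≈⟨ ⊕-¬-exchange x y ⟩
    ¬ (¬ y ⊕ x) ⊕ x    ∎

  ≤-antisym : ∀ {x y} → x ≤ᴹ y → y ≤ᴹ x → x ≈ y
  ≤-antisym {x} {y} x≤y y≤x = begin
    x                  ≈⟨ ≤⇒≈⊕ y≤x ⟩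
    ¬ (¬ x ⊕ y) ⊕ y    ≈⟨ ⊕-¬-exchange x y ⟩
    ¬ (¬ y ⊕ x) ⊕ x    ≈⟨ ≤⇒≈⊕ x≤y ⟨
    y                  ∎

  ≤-refl : ∀ {x} → x ≤ᴹ x
  ≤-refl = ⊕-complementˡ _

  ≤-trans : ∀ {x y z} → x ≤ᴹ y → y ≤ᴹ z → x ≤ᴹ z
  ≤-trans {x} {y} {z} x≤y y≤z = ≤-respʳ (begin
    ¬ (¬ z ⊕ y) ⊕ ¬ (¬ y ⊕ x) ⊕ x     ≈⟨ assoc _ _ x ⟩
    ¬ (¬ z ⊕ y) ⊕ (¬ (¬ y ⊕ x) ⊕ x)   ≈⟨ ⊕-congˡ (≤⇒≈⊕ x≤y) ⟨
    ¬ (¬ z ⊕ y) ⊕ y                   ≈⟨ ≤⇒≈⊕ y≤z ⟨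
    z                                 ∎)
    (x≤y⊕x x _)

  ⊕-monoˡ-≤ : ∀ {x y} z → x ≤ᴹ y → x ⊕ z ≤ᴹ y ⊕ z
  ⊕-monoˡ-≤ {x} {y} z x≤y = ≤-respʳ
    (trans (sym (assoc _ x z)) (⊕-congʳ (sym (≤⇒≈⊕ x≤y))))
    (x≤y⊕x (x ⊕ z) _)

  x≤1 : ∀ x → x ≤ᴹ 1#
  x≤1 x = 1-zeroʳ (¬ x)

  -- The join of `¬ x` and `y` is computed in two ways by the exchange axiom: `x ≤ᴹ ¬ y` makes it
  -- `¬ x`, while absorption turns it into `¬ y ⊕ y`, which is `1#`.
  absorbed-disjoint⇒≈0 : ∀ {x y} → x ⊕ y ≈ y → x ≤ᴹ ¬ y → x ≈ 0#
  absorbed-disjoint⇒≈0 {x} {y} x⊕y≈y x≤¬y = ¬x≈1⇒x≈0 (begin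
    ¬ x                      ≈⟨ identityˡ (¬ x) ⟨
    0# ⊕ ¬ x                 ≈⟨ ⊕-congʳ (trans (¬-cong (trans (comm (¬ y) (¬ x)) x≤¬y)) ¬1≈0) ⟨
    ¬ (¬ y ⊕ ¬ x) ⊕ ¬ x      ≈⟨ ⊕-¬-exchange (¬ x) y ⟨
    ¬ (¬ ¬ x ⊕ y) ⊕ y        ≈⟨ ⊕-congʳ (¬-cong (trans (⊕-congʳ (¬-involutive x)) x⊕y≈y)) ⟩
    ¬ y ⊕ y                  ≈⟨ ⊕-complementˡ y ⟩
    1#                       ∎)

  absorbed-codisjoint⇒≈1 : ∀ {x y} → x ⊕ y ≈ y → ¬ y ≤ᴹ x → y ≈ 1#
  absorbed-codisjoint⇒≈1 {x} {y} x⊕y≈y ¬y≤x = begin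
    y            ≈⟨ x⊕y≈y ⟨
    x ⊕ y        ≈⟨ comm x y ⟩
    y ⊕ x        ≈⟨ ⊕-congʳ (¬-involutive y) ⟨
    ¬ ¬ y ⊕ x    ≈⟨ ¬y≤x ⟩
    1#           ∎

  ·-split : ∀ {j k} x → j ≤ k → k · x ≈ (k ∸ j) · x ⊕ j · x
  ·-split {j} {k} x j≤k = trans
    (Mult.×-congˡ monoid (≡.sym (ℕ.m∸n+n≡m j≤k))) (×-homo-+ x (k ∸ j) j)

  ·-monoˡ-≤ : ∀ {j k} x → j ≤ k → j · x ≤ᴹ k · x
  ·-monoˡ-≤ {j} x j≤k = ≤-respʳ (sym (·-split x j≤k)) (x≤y⊕x (j · x) _)

  -- The next multiple `x ⊕ j · x` lies between `j · x` and `k · x`, so a single repetition stops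
  -- the sequence of multiples.
  ·-≈⇒absorbed : ∀ {j k} x → j < k → j · x ≈ k · x → x ⊕ j · x ≈ j · x
  ·-≈⇒absorbed x j<k jx≈kx =
    ≤-antisym (≤-respʳ (sym jx≈kx) (·-monoˡ-≤ x j<k)) (x≤y⊕x _ x)

  -- Finiteness enters only as an injection into `Fin n`, so that this also applies to a chain
  -- embedded in a finite component.
  ·-stabilises : ∀ {n} {f : Carrier → Fin n} → Injective _≈_ _≡_ f →
                 ∀ x → ∃[ N ] x ⊕ N · x ≈ N · x
  ·-stabilises {n} {f} f-injective x
    -- The `n + 1` multiples from `0 · x` to `n · x` have only `n` codes available.
    with i , j , i<j , eq ← pigeonhole (ℕ.n<1+n n) (λ i → f (toℕ i · x))
    = toℕ i , ·-≈⇒absorbed x i<j (f-injective eq)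

-- Homomorphisms of MV-algebras.

module HomomorphismProperties
  {c ℓ c′ ℓ′ : Level} {A : MVAlgebra c ℓ} {B : MVAlgebra c′ ℓ′}
  {f : MVAlgebra.Carrier A → MVAlgebra.Carrier B} (hom : IsMVHomomorphism A B f)
  where
  private
    module A = MVProperties A
    module B = MVProperties B
  open IsMVHomomorphism hom public
  open IsMonoidHomomorphism isMonoidHomomorphism public

  1-homo : f A.1# B.≈ B.1#
  1-homo = B.trans (¬-homo A.0#) (B.¬-cong ε-homo)

  ·-homo : ∀ n x → f (n A.· x) B.≈ n B.· f x
  ·-homo zero    x = ε-homo
  ·-homo (suc n) x = B.trans (homo x _) (B.⊕-congˡ (·-homo n x))

  ≤-homo : ∀ {x y} → x A.≤ᴹ y → f x B.≤ᴹ f y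
  ≤-homo {x} {y} x≤y = begin
    B.¬ f x B.⊕ f y    ≈⟨ B.⊕-congʳ (¬-homo x) ⟨
    f (A.¬ x) B.⊕ f y  ≈⟨ homo (A.¬ x) y ⟨
    f (A.¬ x A.⊕ y)    ≈⟨ ⟦⟧-cong x≤y ⟩
    f A.1#             ≈⟨ 1-homo ⟩
    B.1#               ∎
    where open SetoidReasoning B.setoid

  -- If `f x` and `f y` agree, then `f` kills both truncated differences of `x` and `y`; these
  -- therefore vanish, which gives both inequalities.
  trivialKernel⇒injective : (∀ {x} → f x B.≈ B.0# → x A.≈ A.0#) →
                            Injective A._≈_ B._≈_ f
  trivialKernel⇒injective kernel fx≈fy =
    A.≤-antisym (reflects-≤ fx≈fy) (reflects-≤ (B.sym fx≈fy))
    where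
    open SetoidReasoning B.setoid
    reflects-≤ : ∀ {x y} → f x B.≈ f y → x A.≤ᴹ y
    reflects-≤ {x} {y} fx≈fy = A.¬x≈0⇒x≈1 (kernel (begin
      f (A.¬ (A.¬ x A.⊕ y))      ≈⟨ ¬-homo _ ⟩
      B.¬ f (A.¬ x A.⊕ y)        ≈⟨ B.¬-cong (homo _ y) ⟩
      B.¬ (f (A.¬ x) B.⊕ f y)    ≈⟨ B.¬-cong (B.⊕-congʳ (¬-homo x)) ⟩
      B.¬ (B.¬ f x B.⊕ f y)      ≈⟨ B.¬-cong (B.⊕-congˡ fx≈fy) ⟨
      B.¬ (B.¬ f x B.⊕ f x)      ≈⟨ B.¬-cong (B.⊕-complementˡ (f x)) ⟩
      B.¬ B.1#                   ≈⟨ B.¬1≈0 ⟩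
      B.0#                       ∎))

-- Fractions with a fixed denominator.

/-cancelʳ-≡ : ∀ e {j k} → + j / suc e ≡ + k / suc e → j ≡ k
/-cancelʳ-≡ e {j} {k} eq
  -- Rationals are stored in lowest terms, so numerators are compared by cross-multiplying
  -- unnormalised representatives.
  with *≡* j*d≡k*d ← fromℚᵘ-injective {mkℚᵘ (+ j) e} {mkℚᵘ (+ k) e} eq
  = ℤ.+-injective (ℤ.*-cancelʳ-≡ (+ j) (+ k) (+ suc e) j*d≡k*d)

fraction : ∀ e {k} → k ≤ suc e → MVAlgebra.Carrier (Ł (suc (suc e)) (s≤s (s≤s z≤n)))
fraction e {k} k≤d = (+ k / suc e , Fractions.0≤/ e k , Fractions./≤1 e k≤d) , k , k≤d , ≡.refl

-- MV-algebras with a least nonzero element, as multiples of that element.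

module _ {c ℓ : Level} (A : MVAlgebra c ℓ) where
  open MVProperties A
  open SetoidReasoning setoid

  module AtomProperties
    (_≟_ : Decidable _≈_) {a : Carrier} (a≉0 : a ≉ 0#)
    (a-least : ∀ {x} → x ≉ 0# → a ≤ᴹ x)
    where

    -- Division by `a` with at most `k` subtractions: if `k · a` lies below `x` and differs from it,
    -- then `x ⊖ k · a` is nonzero, hence at least `a`, and one more copy of `a` fits below `x`.
    multiple-or-above : ∀ k x → (∃[ j ] j < k × j · a ≈ x) ⊎ k · a ≤ᴹ x
    multiple-or-above zero    x = inj₂ (¬0-zeroˡ x)
    multiple-or-above (suc k) x with multiple-or-above k x
    ... | inj₁ (j , j<k , ja≈x) = inj₁ (j , ℕ.m<n⇒m<1+n j<k , ja≈x)
    ... | inj₂ ka≤x with (k · a) ≟ x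
    ...   | yes ka≈x = inj₁ (k , ℕ.n<1+n k , ka≈x)
    ...   | no  ka≉x = inj₂ (≤-respʳ (sym (≤⇒≈⊕ ka≤x))
              (⊕-monoˡ-≤ (k · a) (a-least x⊖ka≉0)))
      where
      x⊖ka≉0 : ¬ (¬ x ⊕ k · a) ≉ 0#
      x⊖ka≉0 x⊖ka≈0 = ka≉x (≤-antisym ka≤x (¬x≈0⇒x≈1 x⊖ka≈0))

    -- Otherwise `¬ x` is nonzero and so above `a`; then `a` is both absorbed by `x` and disjoint
    -- from it, which forces `a` to be `0#`.
    absorbs-atom⇒≈1 : ∀ {x} → a ⊕ x ≈ x → x ≈ 1#
    absorbs-atom⇒≈1 {x} a⊕x≈x with (¬ x) ≟ 0#
    ... | yes ¬x≈0 = ¬x≈0⇒x≈1 ¬x≈0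
    ... | no  ¬x≉0 = ⊥-elim (a≉0 (absorbed-disjoint⇒≈0 a⊕x≈x (a-least ¬x≉0)))

    leastMultiple≈1 : 0# ≉ 1# → ∀ N → N · a ≈ 1# →
                      ∃[ e ] suc e · a ≈ 1# × e · a ≉ 1#
    leastMultiple≈1 0≉1 zero    0≈1   = ⊥-elim (0≉1 0≈1)
    leastMultiple≈1 0≉1 (suc N) 1+Na≈1 with (N · a) ≟ 1#
    ... | yes Na≈1 = leastMultiple≈1 0≉1 N Na≈1
    ... | no  Na≉1 = N , 1+Na≈1 , Na≉1

    module _ {e : ℕ} (da≈1 : suc e · a ≈ 1#) (ea≉1 : e · a ≉ 1#) where
      private
        d : ℕ
        d = suc e

      <d⇒≉1 : ∀ {j} → j < d → j · a ≉ 1#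
      <d⇒≉1 (s≤s j≤e) ja≈1 =
        ea≉1 (≤-antisym (x≤1 _) (≤-respˡ ja≈1 (·-monoˡ-≤ a j≤e)))

      ≥d⇒≈1 : ∀ {j} → d ≤ j → j · a ≈ 1#
      ≥d⇒≈1 d≤j = ≤-antisym (x≤1 _) (≤-respˡ da≈1 (·-monoˡ-≤ a d≤j))

      -- A repetition would make `j · a` absorb `a`, hence equal `1#`, before the `d`-th multiple.
      <⇒·≉ : ∀ {j k} → j < k → k ≤ d → j · a ≉ k · a
      <⇒·≉ j<k k≤d ja≈ka =
        <d⇒≉1 (ℕ.<-≤-trans j<k k≤d) (absorbs-atom⇒≈1 (·-≈⇒absorbed a j<k ja≈ka))

      ·-injective : ∀ {j k} → j ≤ d → k ≤ d → j · a ≈ k · a → j ≡ k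
      ·-injective {j} {k} j≤d k≤d ja≈ka with ℕ.<-cmp j k
      ... | tri< j<k _ _ = ⊥-elim (<⇒·≉ j<k k≤d ja≈ka)
      ... | tri≈ _ j≡k _ = j≡k
      ... | tri> _ _ k<j = ⊥-elim (<⇒·≉ k<j j≤d (sym ja≈ka))

      coordinate : ∀ x → ∃[ k ] k ≤ d × k · a ≈ x
      coordinate x with multiple-or-above d x
      ... | inj₁ (j , j<d , ja≈x) = j , ℕ.<⇒≤ j<d , ja≈x
      -- Since `d · a` is `1#`, lying above it means being `1#`.
      ... | inj₂ da≤x = d , ℕ.≤-refl , ≤-antisym da≤x (≤-respʳ (sym da≈1) (x≤1 x))

      index : Carrier → ℕ
      index x = proj₁ (coordinate x)

      index≤d : ∀ x → index x ≤ d
      index≤d x = proj₁ (proj₂ (coordinate x))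

      index·a≈ : ∀ x → index x · a ≈ x
      index·a≈ x = proj₂ (proj₂ (coordinate x))

      index-unique : ∀ {k x} → k ≤ d → k · a ≈ x → index x ≡ k
      index-unique {k} {x} k≤d ka≈x =
        ·-injective (index≤d x) k≤d (trans (index·a≈ x) (sym ka≈x))

      ·-index-⊕ : ∀ x y → (index x ℕ.+ index y) · a ≈ x ⊕ y
      ·-index-⊕ x y = trans (×-homo-+ a (index x) (index y))
                            (⊕-cong (index·a≈ x) (index·a≈ y))

      -- Both bounds come from sums equal to `1#`. From `¬ x ⊕ x` the two indices add up to at least
      -- `d`, which bounds `¬ x` below; from `(d ∸ j) · a ⊕ j · a` follows the bound above.
      index-¬ : ∀ x → index (¬ x) ≡ d ∸ index x
      index-¬ x = index-unique (ℕ.m∸n≤m d j) (≤-antisym lower upper)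
        where
        j k : ℕ
        j = index x
        k = index (¬ x)

        ka⊕ja≈1 : (k ℕ.+ j) · a ≈ 1#
        ka⊕ja≈1 = trans (·-index-⊕ (¬ x) x) (⊕-complementˡ x)

        d≤k+j : d ≤ k ℕ.+ j
        d≤k+j = ℕ.≮⇒≥ (λ k+j<d → <d⇒≉1 k+j<d ka⊕ja≈1)

        lower : (d ∸ j) · a ≤ᴹ ¬ x
        lower = ≤-respʳ (index·a≈ (¬ x))
          (·-monoˡ-≤ a (ℕ.m≤n+o⇒m∸n≤o d j (ℕ.≤-trans d≤k+j (ℕ.≤-reflexive (ℕ.+-comm k j)))))

        upper : ¬ x ≤ᴹ (d ∸ j) · a
        upper = begin
          ¬ ¬ x ⊕ (d ∸ j) · a     ≈⟨ ⊕-congʳ (¬-involutive x) ⟩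
          x ⊕ (d ∸ j) · a         ≈⟨ comm x _ ⟩
          (d ∸ j) · a ⊕ x         ≈⟨ ⊕-congˡ (index·a≈ x) ⟨
          (d ∸ j) · a ⊕ j · a     ≈⟨ ·-split a (index≤d x) ⟨
          d · a                   ≈⟨ da≈1 ⟩
          1#                      ∎

      index/d : Carrier → ℚ
      index/d x = + index x / d

      index/d-unique : ∀ {k x} → k ≤ d → k · a ≈ x → index/d x ≡ + k / d
      index/d-unique k≤d ka≈x = ≡.cong (λ k → + k / d) (index-unique k≤d ka≈x)

      index/d-⊕ : ∀ x y → index/d (x ⊕ y) ≡ index/d x Truncated+.⊞ index/d y
      index/d-⊕ x y = ≡.trans (sum (ℕ.≤-total (j ℕ.+ k) d))
                              (≡.cong (_⊓ 1ℚ) (≡.sym (Fractions.+-/ e j k)))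
        where
        j k : ℕ
        j = index x
        k = index y

        sum : j ℕ.+ k ≤ d ⊎ d ≤ j ℕ.+ k → index/d (x ⊕ y) ≡ (+ (j ℕ.+ k) / d) ⊓ 1ℚ
        sum (inj₁ j+k≤d) = ≡.trans (index/d-unique j+k≤d (·-index-⊕ x y))
          (≡.sym (p≤q⇒p⊓q≡p (Fractions./≤1 e j+k≤d)))
        -- From the `d`-th on, all multiples of `a` are `1#`, which matches the truncation of the
        -- rational sum at `1ℚ`.
        sum (inj₂ d≤j+k) = ≡.trans
          (index/d-unique ℕ.≤-refl (trans da≈1 (trans (sym (≥d⇒≈1 d≤j+k)) (·-index-⊕ x y))))
          (≡.trans (Fractions.d/d e) (≡.sym (p≥q⇒p⊓q≡q (Fractions.1≤/ e d≤j+k))))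

      ≅Ł : A ≅ Ł (suc d) (s≤s (s≤s z≤n))
      ≅Ł = record
        { to = λ x → fraction e (index≤d x)
        ; isMVHomomorphism = record
          { isMonoidHomomorphism = record
            { isMagmaHomomorphism = record
              { isRelHomomorphism = record
                { cong = λ {x} {y} x≈y →
                    index/d-unique (index≤d y) (trans (index·a≈ y) (sym x≈y)) }
              ; homo = index/d-⊕
              }
            ; ε-homo = ≡.trans (index/d-unique z≤n refl) (≡.sym (Fractions.0/d e))
            }
          ; ¬-homo = λ x → ≡.trans (≡.cong (λ k → + k / d) (index-¬ x))
                                   (≡.sym (Fractions.1-/ e (index≤d x)))
          }
        -- The numerator `k` carried by the membership proof supplies the preimage.
        ; bijective = injective , λ { (_ , k , k≤d , q≡k/d) → k · a , λ z≈ka →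
            ≡.trans (index/d-unique k≤d (sym z≈ka)) (≡.sym q≡k/d) }
        }
        where
        injective : ∀ {x y} → index/d x ≡ index/d y → x ≈ y
        injective {x} {y} eq = begin
          x              ≈⟨ index·a≈ x ⟨
          index x · a    ≡⟨ ≡.cong (_· a) (/-cancelʳ-≡ e {index x} {index y} eq) ⟩
          index y · a    ≈⟨ index·a≈ y ⟩
          y              ∎

-- Finite chains and profinite chains.

module _ {u : Level} (em : ExcludedMiddle u) (A : MVAlgebra u u)
         (nontrivial : Nontrivial A) (chain : IsChain A) where
  open MVProperties A

  -- Some codes may have no preimage, so excluded middle decides whether a code belongs to a nonzero
  -- element. If so, injectivity makes that element unique, and the chain order picks the smaller of
  -- it and the current candidate.
  leastNonzeroOver : ∀ {n} {f : Carrier → Fin n} → Injective _≈_ _≡_ f → (is : List (Fin n)) →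
    ∃[ a ] a ≉ 0# × (∀ {x} → x ≉ 0# → f x ∈ is → a ≤ᴹ x)
  -- With no codes to dominate any nonzero element serves; non-triviality provides `1#`.
  leastNonzeroOver f-injective [] = 1# , nontrivial ∘ sym , λ _ ()
  leastNonzeroOver {f = f} f-injective (i ∷ is)
    with leastNonzeroOver f-injective is | em {∃[ x ] x ≉ 0# × f x ≡ i}
  ... | a , a≉0 , a-least | no ∄x = a , a≉0 , λ
        { x≉0 (here fx≡i)  → ⊥-elim (∄x (_ , x≉0 , fx≡i))
        ; x≉0 (there fx∈is) → a-least x≉0 fx∈is }
  ... | a , a≉0 , a-least | yes (b , b≉0 , fb≡i) with chain a b
  ...   | inj₁ a≤b = a , a≉0 , λ
          { x≉0 (here fx≡i)  → ≤-respʳ (f-injective (≡.trans fb≡i (≡.sym fx≡i))) a≤b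
          ; x≉0 (there fx∈is) → a-least x≉0 fx∈is }
  ...   | inj₂ b≤a = b , b≉0 , λ
          { x≉0 (here fx≡i)  → ≤-respʳ (f-injective (≡.trans fb≡i (≡.sym fx≡i))) ≤-refl
          ; x≉0 (there fx∈is) → ≤-trans b≤a (a-least x≉0 fx∈is) }

  finiteChain⇒≅Ł : ∀ {n} {f : Carrier → Fin n} → Injective _≈_ _≡_ f →
                   ∃[ m ] Σ[ 2≤m ∈ 2 ≤ m ] A ≅ Ł m 2≤m
  finiteChain⇒≅Ł {n} {f} f-injective
    with a , a≉0 , a-least′ ← leastNonzeroOver f-injective (allFin n)
    with N , a⊕Na≈Na ← ·-stabilises f-injective a
    = let a-least : ∀ {x} → x ≉ 0# → a ≤ᴹ x
          a-least x≉0 = a-least′ x≉0 (∈-allFin (f _))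
          open AtomProperties A (λ _ _ → em) a≉0 a-least
          -- The stable multiple `N · a` absorbs the atom, so it is `1#` and the search downwards
          -- can start at `N`.
          e , da≈1 , ea≉1 = leastMultiple≈1 nontrivial N (absorbs-atom⇒≈1 a⊕Na≈Na)
      in suc (suc e) , s≤s (s≤s z≤n) , ≅Ł da≈1 ea≉1

  module _ (S : InverseSystem u) (finite : ∀ k → Finite (InverseSystem.algebra S k))
           (iso : A ≅ InverseSystem.limit S) where
    open InverseSystem S using (_⊑_; algebra; φ; φ-homo)
    private
      module At k = MVProperties (algebra k)
      module iso = _≅_ iso
      module isoHomo = HomomorphismProperties iso.isMVHomomorphism

    π : ∀ k → Carrier → At.Carrier k
    π k x = proj₁ (iso.to x) k

    π-homo : ∀ k → IsMVHomomorphism A (algebra k) (π k)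
    π-homo k = record
      { isMonoidHomomorphism = record
        { isMagmaHomomorphism = record
          { isRelHomomorphism = record { cong = λ x≈y → isoHomo.⟦⟧-cong x≈y k }
          ; homo = λ x y → isoHomo.homo x y k
          }
        ; ε-homo = isoHomo.ε-homo k
        }
      ; ¬-homo = λ x → isoHomo.¬-homo x k
      }

    private
      module π k = HomomorphismProperties (π-homo k)
      module Φ {j k} (j⊑k : j ⊑ k) = HomomorphismProperties (φ-homo j⊑k)

    π-thread : ∀ {j k} (j⊑k : j ⊑ k) x → At._≈_ j (φ j⊑k (π k x)) (π j x)
    π-thread j⊑k x = proj₂ (iso.to x) j⊑k

    π-jointlyInjective : ∀ {x y} → (∀ k → At._≈_ k (π k x) (π k y)) → x ≈ y
    π-jointlyInjective = proj₁ iso.bijective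

    fin-injection : ∀ k → Injection (At.setoid k) (≡.setoid (Fin (proj₁ (finite k))))
    fin-injection k = Inverse⇒Injection (proj₂ (finite k))

    -- If `0#` and `1#` agreed in every component, they would have equal projections and so agree in
    -- `A`.
    nontrivialComponent : ∃[ k ] At._≉_ k (At.0# k) (At.1# k)
    nontrivialComponent with em {∃[ k ] At._≉_ k (At.0# k) (At.1# k)}
    ... | yes found = found
    ... | no  none  = ⊥-elim (nontrivial (π-jointlyInjective λ k →
            At.trans k (π.ε-homo k) (At.trans k (0≈1 k) (At.sym k (π.1-homo k)))))
      where
      0≈1 : ∀ k → At._≈_ k (At.0# k) (At.1# k)
      0≈1 k with em {At._≈_ k (At.0# k) (At.1# k)}
      ... | yes eq  = eq
      ... | no  neq = ⊥-elim (none (k , neq))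

    vanishes-above : ∀ {k m x} → At._≉_ k (At.0# k) (At.1# k) → k ⊑ m →
                     At._≈_ k (π k x) (At.0# k) → At._≈_ m (π m x) (At.0# m)
    vanishes-above {k} {m} {x} 0≉1 k⊑m πₖx≈0
      with N , stable ← At.·-stabilises m (Injection.injective (fin-injection m)) (π m x)
      -- The comparison is made in `A` and then projected, because the component at `m` is not
      -- assumed to be a chain.
      with chain x (¬ (N · x))
    ... | inj₁ x≤¬Nx = At.absorbed-disjoint⇒≈0 m stable
          (At.≤-respʳ m (At.trans m (π.¬-homo m _) (At.¬-cong m (π.·-homo m N x)))
            (π.≤-homo m x≤¬Nx))
    ... | inj₂ ¬Nx≤x = ⊥-elim (0≉1 (begin
          Aₖ.0#                 ≈⟨ ·-zero N ⟨
          N Aₖ.· Aₖ.0#          ≈⟨ Aₖ.×-congʳ N πₖx≈0 ⟨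
          N Aₖ.· π k x          ≈⟨ π.·-homo k N x ⟨
          π k (N · x)           ≈⟨ π-thread k⊑m (N · x) ⟨
          φ k⊑m (π m (N · x))   ≈⟨ Φ.⟦⟧-cong k⊑m πₘNx≈1 ⟩
          φ k⊑m (At.1# m)       ≈⟨ Φ.1-homo k⊑m ⟩
          Aₖ.1#                 ∎))
      where
      module Aₖ = MVProperties (algebra k)
      open SetoidReasoning Aₖ.setoid

      ·-zero : ∀ N → N Aₖ.· Aₖ.0# Aₖ.≈ Aₖ.0#
      ·-zero zero    = Aₖ.refl
      ·-zero (suc N) = Aₖ.trans (Aₖ.identityˡ _) (·-zero N)

      πₘNx≈1 : At._≈_ m (π m (N · x)) (At.1# m)
      πₘNx≈1 = At.trans m (π.·-homo m N x) (At.absorbed-codisjoint⇒≈1 m stable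
        (At.≤-respˡ m (At.trans m (π.¬-homo m _) (At.¬-cong m (π.·-homo m N x)))
          (π.≤-homo m ¬Nx≤x)))

    π-injective : ∀ {k} → At._≉_ k (At.0# k) (At.1# k) →
                  Injective _≈_ (At._≈_ k) (π k)
    π-injective {k} 0≉1 = π.trivialKernel⇒injective k λ {x} πₖx≈0 →
      π-jointlyInjective λ j →
        -- Directedness links an arbitrary `j` to `k`: vanishing at `k` is lifted to the common
        -- bound `m` and then pushed down to `j`.
        let m , j⊑m , k⊑m = IsDirected.upperBound (InverseSystem.isDirected S) j k
            πₘx≈0 = vanishes-above 0≉1 k⊑m πₖx≈0
        in At.trans j (At.sym j (π-thread j⊑m x))
             (At.trans j (Φ.⟦⟧-cong j⊑m πₘx≈0)
               (At.trans j (Φ.ε-homo j⊑m) (At.sym j (π.ε-homo j))))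

    profiniteChain⇒≅Ł : ∃[ n ] Σ[ 2≤n ∈ 2 ≤ n ] A ≅ Ł n 2≤n
    profiniteChain⇒≅Ł =
      let k , 0≉1 = nontrivialComponent
      in finiteChain⇒≅Ł (λ eq → π-injective 0≉1 (Injection.injective (fin-injection k) eq))

-- Finiteness of algebras isomorphic to some `Ł n`.

module _ {c ℓ : Level} (A : MVAlgebra c ℓ) where
  open MVProperties A

  -- Finiteness is transferred to `A` itself because an inverse system for `A` must consist of
  -- algebras in its universe, whereas `Ł n` lies in the lowest one.
  ≅Ł⇒Finite : ∀ {n} (2≤n : 2 ≤ n) → A ≅ Ł n 2≤n → Finite A
  ≅Ł⇒Finite {suc (suc e)} (s≤s (s≤s _)) iso = suc (suc e) , record
    { to        = to′
    ; from      = from′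
    ; to-cong   = to′-cong
    ; from-cong = λ { ≡.refl → refl }
    ; inverse   = (λ {i} x≈ → ≡.trans (to′-cong x≈) (to′∘from′ i))
                , (λ { {x} ≡.refl → from′∘to′ x })
    }
    where
    open _≅_ iso
    open HomomorphismProperties isMVHomomorphism using (⟦⟧-cong)

    numerator : Carrier → ℕ
    numerator x = proj₁ (proj₂ (to x))

    numerator≤ : ∀ x → numerator x ≤ suc e
    numerator≤ x = proj₁ (proj₂ (proj₂ (to x)))

    to≡ : ∀ x → proj₁ (proj₁ (to x)) ≡ + numerator x / suc e
    to≡ x = proj₂ (proj₂ (proj₂ (to x)))

    -- Equality in `Ł n` ignores membership proofs, so the numerator read off from one must be shown
    -- to depend on the value alone.
    numerator-unique : ∀ {x k} → proj₁ (proj₁ (to x)) ≡ + k / suc e → numerator x ≡ k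
    numerator-unique {x} eq = /-cancelʳ-≡ e (≡.trans (≡.sym (to≡ x)) eq)

    to′ : Carrier → Fin (suc (suc e))
    to′ x = fromℕ< (s≤s (numerator≤ x))

    toℕ-to′ : ∀ x → toℕ (to′ x) ≡ numerator x
    toℕ-to′ x = toℕ-fromℕ< (s≤s (numerator≤ x))

    preimage : (i : Fin (suc (suc e))) →
      ∃[ x ] (∀ {z} → z ≈ x → proj₁ (proj₁ (to z)) ≡ + toℕ i / suc e)
    preimage i = proj₂ bijective (fraction e (toℕ≤pred[n] i))

    from′ : Fin (suc (suc e)) → Carrier
    from′ i = proj₁ (preimage i)

    to′-cong : ∀ {x y} → x ≈ y → to′ x ≡ to′ y
    to′-cong {x} {y} x≈y = toℕ-injective (≡.trans (toℕ-to′ x)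
      (≡.trans (numerator-unique (≡.trans (⟦⟧-cong x≈y) (to≡ y))) (≡.sym (toℕ-to′ y))))

    to′∘from′ : ∀ i → to′ (from′ i) ≡ i
    to′∘from′ i = toℕ-injective
      (≡.trans (toℕ-to′ (from′ i)) (numerator-unique (proj₂ (preimage i) refl)))

    from′∘to′ : ∀ x → from′ (to′ x) ≈ x
    from′∘to′ x = proj₁ bijective (≡.trans (proj₂ (preimage (to′ x)) refl)
      (≡.trans (≡.cong (λ k → + k / suc e) (toℕ-to′ x)) (≡.sym (to≡ x))))

-- Finite algebras as limits over a one-point index.

module _ {u : Level} (A : MVAlgebra u u) where
  open MVProperties A

  constantSystem : InverseSystem u
  constantSystem = record
    -- The order laws are left to inference: each takes values in a one-element type.
    { index = record
      { Carrier = ⊤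
      ; _≈_ = λ _ _ → ⊤
      ; _≤_ = λ _ _ → ⊤
      }
    ; isDirected = record { inhabited = tt ; upperBound = λ _ _ → tt , tt , tt }
    ; algebra = λ _ → A
    ; φ = λ _ x → x
    ; φ-homo = λ _ → record
      { isMonoidHomomorphism = record
        { isMagmaHomomorphism = record
          { isRelHomomorphism = record { cong = λ x≈y → x≈y }
          ; homo = λ _ _ → refl
          }
        ; ε-homo = refl
        }
      ; ¬-homo = λ _ → refl
      }
    ; φ-id = λ _ _ → refl
    ; φ-∘ = λ _ _ _ _ → refl
    }

  finite⇒profinite : Finite A → Profinite A
  finite⇒profinite finite = constantSystem , (λ _ → finite) , record
    { to = λ x → (λ _ → x) , λ _ → refl
    ; isMVHomomorphism = record
      { isMonoidHomomorphism = record
        { isMagmaHomomorphism = record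
          { isRelHomomorphism = record { cong = λ x≈y _ → x≈y }
          ; homo = λ _ _ _ → refl
          }
        ; ε-homo = λ _ → refl
        }
      ; ¬-homo = λ _ _ → refl
      }
    ; bijective = (λ eq → eq tt) , λ y → proj₁ y tt , λ z≈y _ → z≈y
    }

corollary2p7 : ∀ {u} → ExcludedMiddle u →
    (A : MVAlgebra u u) → Nontrivial A → IsChain A →
    Profinite A ⇔ (∃[ n ] Σ[ 2≤n ∈ 2 ≤ n ] A ≅ Ł n 2≤n)
corollary2p7 em A nontrivial chain = mk⇔
  (λ (S , finite , iso) → profiniteChain⇒≅Ł em A nontrivial chain S finite iso)
  (λ (_ , 2≤n , iso) → finite⇒profinite A (≅Ł⇒Finite A 2≤n iso))
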